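{- Let $n\ge 1$, let $\sigma\in\mathcal{S}_n(231)$, and let $\Phi:\mathcal{S}_n(231)\to\mathcal{D}_n$ be the bijection defined in the context. Then $$\operatorname{Set}_X(\Phi(\sigma))=\operatorname{Des}(\sigma),\qquad \operatorname{Set}_Y(\Phi(\sigma))=\operatorname{iDes}(\sigma),$$ and, in particular, $$\operatorname{maj}(\Phi(\sigma))=\operatorname{maj}(\sigma)+\operatorname{imaj}(\sigma).$$
   Context: $\mathcal{S}_n$ is the symmetric group on $[n]=\{1,\dots,n\}$; $\mathcal{S}_n(231)$ is the set of $\sigma\in\mathcal{S}_n$ with no $i<j<k$ satisfying $\sigma_k<\sigma_i<\sigma_j$. For $\sigma\in\mathcal{S}_n$: $\operatorname{Des}(\sigma)=\{i : 1\le i<n,\ \sigma_i>\sigma_{i+1}\}$, $\operatorname{iDes}(\sigma)=\operatorname{Des}(\sigma^{ -1})$, $\operatorname{maj}(\sigma)=\sum_{i\in\operatorname{Des}(\sigma)}i$, $\operatorname{imaj}(\sigma)=\operatorname{maj}(\sigma^{ -1})$. A Dyck path of semilength $n$ is a word $D=D_1\cdots D_{2n}$ with $n$ letters $0$ (north steps) and $n$ letters $1$ (east steps) such that every prefix contains at least as many $0$'s as $1$'s; $\mathcal{D}_n$ is the set of these. It is identified with a lattice path from $(0,0)$ to $(n,n)$. A descent (or valley) of $D$ is an $i$ with $1\le i<2n$, $D_i=1$, $D_{i+1}=0$; $\operatorname{Des}(D)$ is the set of descents and $\operatorname{maj}(D)=\sum_{i\in\operatorname{Des}(D)}i$. The coordinates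 of the descent $i$ are $(x,y)$ with $x$ the number of $1$'s and $y$ the number of $0$'s among $D_1,\dots,D_i$. $\operatorname{Set}_X(D)$ and $\operatorname{Set}_Y(D)$ are the sets of $x$-coordinates and of $y$-coordinates of the descents of $D$. Definition of $\Phi$: for $\sigma\in\mathcal{S}_n(231)$ the sets $\operatorname{Des}(\sigma)=\{i_1<\dots<i_k\}$ and $\operatorname{iDes}(\sigma)=\{i'_1<\dots<i'_k\}$ have the same cardinality; set $i_{k+1}:=n$, $i'_{k+1}:=n$. Then $\Phi(\sigma)$ is the Dyck path consisting of $i'_1$ $0$'s, then $i_1$ $1$'s, then $i'_2-i'_1$ $0$'s, then $i_2-i_1$ $1$'s, and so on, ending with $i'_{k+1}-i'_k$ $0$'s and $i_{k+1}-i_k$ $1$'s (for $k=0$ it is $0^n1^n$). -}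

module Defs where

open import Data.Empty using (⊥-elim)
open import Data.Fin.Base as Fin using (Fin; toℕ; fromℕ<)
import Data.Fin.Properties as Fin
open import Data.Fin.Permutation
  using (Permutation′; _⟨$⟩ʳ_; _⟨$⟩ˡ_; inverseˡ; inverseʳ; flip)
open import Data.List.Base
  using (List; []; _∷_; _++_; _∷ʳ_; length; lookup; filter; take; replicate; upTo; applyUpTo; zip)
open import Data.List.Properties using (filter-accept; filter-none)
open import Data.List.Relation.Unary.All as All using (All; []; _∷_)
import Data.List.Relation.Unary.All.Properties as All
open import Data.List.Relation.Unary.AllPairs using (AllPairs; []; _∷_)
import Data.List.Relation.Unary.AllPairs.Properties as AllPairs
open import Data.List.Relation.Binary.Pointwise using (Pointwise; []; _∷_)
open import Data.Nat.Base
open import Data.Nat.ListAction using (sum)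
open import Data.Nat.Properties
open import Data.Product.Base using (Σ-syntax; ∃-syntax; _×_; _,_; proj₁)
open import Data.Vec.Functional using (Vector)
open import Function.Base using (_∘_; id)
open import Level using (0ℓ)
open import Relation.Binary.Definitions using (DecidableEquality; tri<; tri≈; tri>)
open import Relation.Binary.PropositionalEquality
  using (_≡_; _≢_; refl; sym; trans; cong; cong₂; subst; subst₂)
open import Relation.Nullary using (¬_; Dec; yes; no; does)
open import Relation.Nullary.Decidable using (_×-dec_)
open import Relation.Unary using (Pred; Decidable)
open import Data.Bool.Base using (true; false; if_then_else_)
open import Algebra.Properties.CommutativeMonoid.Sum +-0-commutativeMonoid
  using (sum-permute; ∑-distrib-+; sum-cong-≗) renaming (sum to sumᶠ)

------------------------------------------------------------------------
-- Positions, values and descents are 1-based natural numbers, as in one-line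
-- notation, whereas `Fin n` starts at 0.

[_]₁ : ∀ {n} → Fin n → ℕ
[ a ]₁ = suc (toℕ a)

-- Increasing enumeration of the members of P below n.
elements : ∀ {P : Pred ℕ 0ℓ} → Decidable P → ℕ → List ℕ
elements P? n = filter P? (upTo n)

------------------------------------------------------------------------
-- Permutations: σ ⟨$⟩ʳ a is the letter σ_a, and flip σ is the inverse.

Avoids231 : ∀ {n} → Permutation′ n → Set
Avoids231 {n} σ = ∀ (i j k : Fin n) → i Fin.< j → j Fin.< k →
  ¬ ((σ ⟨$⟩ʳ k) Fin.< (σ ⟨$⟩ʳ i) × (σ ⟨$⟩ʳ i) Fin.< (σ ⟨$⟩ʳ j))

S₂₃₁ : ℕ → Set
S₂₃₁ n = Σ[ σ ∈ Permutation′ n ] Avoids231 σ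

-- The bounds 1 ≤ i < n are implied by a and b being positions.
Des : ∀ {n} → Permutation′ n → Pred ℕ 0ℓ
Des {n} σ i = ∃[ a ] ∃[ b ]
  [ a ]₁ ≡ i × [ b ]₁ ≡ suc i × (σ ⟨$⟩ʳ b) Fin.< (σ ⟨$⟩ʳ a)

Des? : ∀ {n} (σ : Permutation′ n) → Decidable (Des σ)
Des? σ i = Fin.any? λ a → Fin.any? λ b →
  ([ a ]₁ ≟ i) ×-dec ([ b ]₁ ≟ suc i) ×-dec ((σ ⟨$⟩ʳ b) Fin.<? (σ ⟨$⟩ʳ a))

iDes : ∀ {n} → Permutation′ n → Pred ℕ 0ℓ
iDes σ = Des (flip σ)

iDes? : ∀ {n} (σ : Permutation′ n) → Decidable (iDes σ)
iDes? σ = Des? (flip σ)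

maj : ∀ {n} → Permutation′ n → ℕ
maj {n} σ = sum (elements (Des? σ) n)

imaj : ∀ {n} → Permutation′ n → ℕ
imaj σ = maj (flip σ)

------------------------------------------------------------------------
-- Dyck paths: 𝟘 is a north step and 𝟙 an east step.

data Step : Set where
  𝟘 𝟙 : Step

_≟ˢ_ : DecidableEquality Step
𝟘 ≟ˢ 𝟘 = yes refl
𝟘 ≟ˢ 𝟙 = no λ ()
𝟙 ≟ˢ 𝟘 = no λ ()
𝟙 ≟ˢ 𝟙 = yes refl

Word : Set
Word = List Step

#[_] : Step → Word → ℕ
#[ s ] w = length (filter (_≟ˢ s) w)

record Dyck (n : ℕ) : Set where
  field
    word     : Word
    norths   : #[ 𝟘 ] word ≡ n
    easts    : #[ 𝟙 ] word ≡ n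
    prefixes : ∀ i → #[ 𝟙 ] (take i word) ≤ #[ 𝟘 ] (take i word)

open Dyck public

DesW : Word → Pred ℕ 0ℓ
DesW w i = ∃[ a ] ∃[ b ]
  [ a ]₁ ≡ i × [ b ]₁ ≡ suc i × lookup w a ≡ 𝟙 × lookup w b ≡ 𝟘

DesW? : (w : Word) → Decidable (DesW w)
DesW? w i = Fin.any? λ a → Fin.any? λ b →
  ([ a ]₁ ≟ i) ×-dec ([ b ]₁ ≟ suc i) ×-dec (lookup w a ≟ˢ 𝟙) ×-dec (lookup w b ≟ˢ 𝟘)

DesD : ∀ {n} → Dyck n → Pred ℕ 0ℓ
DesD D = DesW (word D)

majD : ∀ {n} → Dyck n → ℕ
majD {n} D = sum (elements (DesW? (word D)) (2 * n))

xcoord ycoord : ∀ {n} → Dyck n → ℕ → ℕ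
xcoord D i = #[ 𝟙 ] (take i (word D))
ycoord D i = #[ 𝟘 ] (take i (word D))

SetX SetY : ∀ {n} → Dyck n → Pred ℕ 0ℓ
SetX D x = ∃[ i ] DesD D i × xcoord D i ≡ x
SetY D y = ∃[ i ] DesD D i × ycoord D i ≡ y

------------------------------------------------------------------------
-- The word of Φ(σ)

-- From the point (x , y), go north and then east to each listed point in turn.
path : ℕ × ℕ → List (ℕ × ℕ) → Word
path _       []               = []
path (x , y) ((x′ , y′) ∷ ps) =
  replicate (y′ ∸ y) 𝟘 ++ replicate (x′ ∸ x) 𝟙 ++ path (x′ , y′) ps

-- The points are (i_j , i′_j) for 1 ≤ j ≤ k + 1, where the last one is (n , n).
-- The two zipped lists have equal length when σ avoids 231: see des≡ides.
Φword : ∀ {n} → Permutation′ n → Word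
Φword {n} σ = path (0 , 0)
  (zip (elements (Des? σ) n ∷ʳ n) (elements (iDes? σ) n ∷ʳ n))

------------------------------------------------------------------------
-- The rest shows that Φword σ is a Dyck path when σ avoids 231.

ind : ∀ {P : Set} → Dec P → ℕ
ind d = if does d then 1 else 0

ind-mono : ∀ {P Q : Set} (p : Dec P) (q : Dec Q) → (P → Q) → ind p ≤ ind q
ind-mono (no _)  q       f = z≤n
ind-mono (yes p) (yes _) f = ≤-refl
ind-mono (yes p) (no ¬q) f = ⊥-elim (¬q (f p))

ind-cong : ∀ {P Q : Set} (p : Dec P) (q : Dec Q) → (P → Q) → (Q → P) → ind p ≡ ind q
ind-cong p q f g = ≤-antisym (ind-mono p q f) (ind-mono q p g)

ind-no : ∀ {P : Set} (p : Dec P) → ¬ P → ind p ≡ 0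
ind-no (yes p) ¬p = ⊥-elim (¬p p)
ind-no (no _)  ¬p = refl

ind-yes : ∀ {P : Set} (p : Dec P) → P → ind p ≡ 1
ind-yes (yes _) p = refl
ind-yes (no ¬p) p = ⊥-elim (¬p p)

ind-exchange : ∀ {D P Q : Set} (d : Dec D) (p : Dec P) (q : Dec Q) → (Q → ¬ P → D) →
               ind (d ×-dec p) + ind q ≤ ind (d ×-dec q) + ind p
ind-exchange (yes _) (yes _) (yes _) f = ≤-refl
ind-exchange (yes _) (yes _) (no _)  f = ≤-refl
ind-exchange (yes _) (no _)  (yes _) f = ≤-refl
ind-exchange (yes _) (no _)  (no _)  f = ≤-refl
ind-exchange (no _)  (yes _) (yes _) f = ≤-refl
ind-exchange (no _)  (yes _) (no _)  f = z≤n
ind-exchange (no ¬d) (no ¬p) (yes q) f = ⊥-elim (¬d (f q ¬p))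
ind-exchange (no _)  (no _)  (no _)  f = ≤-refl

sumᶠ-mono : ∀ {n} (f g : Vector ℕ n) → (∀ a → f a ≤ g a) → sumᶠ f ≤ sumᶠ g
sumᶠ-mono {zero}  f g h = z≤n
sumᶠ-mono {suc n} f g h =
  +-mono-≤ (h Fin.zero) (sumᶠ-mono (f ∘ Fin.suc) (g ∘ Fin.suc) (h ∘ Fin.suc))

sumᶠ-mono-< : ∀ {n} (f g : Vector ℕ n) → (∀ a → f a ≤ g a) →
              ∀ a → f a < g a → sumᶠ f < sumᶠ g
sumᶠ-mono-< {suc n} f g h Fin.zero    lt =
  +-mono-<-≤ lt (sumᶠ-mono (f ∘ Fin.suc) (g ∘ Fin.suc) (h ∘ Fin.suc))
sumᶠ-mono-< {suc n} f g h (Fin.suc a) lt =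
  +-mono-≤-< (h Fin.zero) (sumᶠ-mono-< (f ∘ Fin.suc) (g ∘ Fin.suc) (h ∘ Fin.suc) a lt)

sumᶠ-snoc : ∀ n (g : ℕ → ℕ) → sumᶠ {n} (g ∘ toℕ) + g n ≡ sumᶠ {suc n} (g ∘ toℕ)
sumᶠ-snoc zero    g = sym (+-identityʳ (g 0))
sumᶠ-snoc (suc n) g =
  trans (+-assoc (g 0) _ _) (cong (g 0 +_) (sumᶠ-snoc n (g ∘ suc)))

sumᶠ-shift : ∀ n (g : ℕ → ℕ) → g 0 ≡ 0 → g n ≡ 0 →
             sumᶠ {n} (g ∘ toℕ) ≡ sumᶠ {n} (g ∘ suc ∘ toℕ)
sumᶠ-shift n g g0 gn = trans (sym (+-identityʳ _))
  (trans (cong (sumᶠ {n} (g ∘ toℕ) +_) (sym gn))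
  (trans (sumᶠ-snoc n g) (cong (_+ sumᶠ {n} (g ∘ suc ∘ toℕ)) g0)))

sumᶠ-zero : ∀ n (f : Vector ℕ n) → (∀ a → f a ≡ 0) → sumᶠ f ≡ 0
sumᶠ-zero zero    f h = refl
sumᶠ-zero (suc n) f h = cong₂ _+_ (h Fin.zero) (sumᶠ-zero n (f ∘ Fin.suc) (h ∘ Fin.suc))

≤-vs-< : ∀ n m → sumᶠ {n} (λ a → ind (toℕ a ≤? m)) ≤ suc (sumᶠ {n} (λ a → ind (toℕ a <? m)))
≤-vs-< zero    m       = z≤n
≤-vs-< (suc n) zero    = s≤s (≤-trans (≤-reflexive
  (sumᶠ-zero n _ (λ a → ind-no (suc (toℕ a) ≤? 0) λ ()))) z≤n)
≤-vs-< (suc n) (suc m) = s≤s (begin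
    sumᶠ {n} (λ a → ind (suc (toℕ a) ≤? suc m))
  ≤⟨ sumᶠ-mono {n} _ _ (λ a → ind-mono (suc (toℕ a) ≤? suc m) (toℕ a ≤? m) s≤s⁻¹) ⟩
    sumᶠ {n} (λ a → ind (toℕ a ≤? m))
  ≤⟨ ≤-vs-< n m ⟩
    suc (sumᶠ {n} (λ a → ind (toℕ a <? m)))
  ≤⟨ s≤s (sumᶠ-mono {n} _ _ (λ a → ind-mono (toℕ a <? m) (suc (toℕ a) <? suc m) s≤s)) ⟩
    suc (sumᶠ {n} (λ a → ind (suc (toℕ a) <? suc m))) ∎)
  where open ≤-Reasoning

------------------------------------------------------------------------

module _ {n : ℕ} (σ : Permutation′ n) (av : Avoids231 σ) where

  private
    s : Fin n → Fin n
    s = σ ⟨$⟩ʳ_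

    t : Fin n → ℕ
    t a = toℕ (s a)

    s-inj : ∀ {a b} → t a ≡ t b → a ≡ b
    s-inj eq = trans (sym (inverseˡ σ))
      (trans (cong (σ ⟨$⟩ˡ_) (Fin.toℕ-injective eq)) (inverseˡ σ))

    D : Fin n → Set
    D a = Des σ [ a ]₁

    D? : ∀ a → Dec (D a)
    D? a = Des? σ [ a ]₁

    mkD : ∀ {a b} → toℕ b ≡ suc (toℕ a) → t b < t a → D a
    mkD {a} {b} e lt = a , b , refl , cong suc e , lt

    unD : ∀ {a} → D a → ∃[ b ] toℕ b ≡ suc (toℕ a) × t b < t a
    unD {a} (a′ , b , e₁ , e₂ , lt) with Fin.toℕ-injective (suc-injective e₁)
    ... | refl = b , suc-injective e₂ , lt

    next : ∀ {a p : Fin n} → toℕ a < toℕ p → ∃[ b ] toℕ b ≡ suc (toℕ a)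
    next {a} {p} lt = fromℕ< le , Fin.toℕ-fromℕ< le
      where
      le : suc (toℕ a) < n
      le = ≤-<-trans lt (Fin.toℕ<n p)

    -- Positions p after a with t p < t a force any ascent after a to start
    -- a 231 pattern.
    mustD : ∀ {a p} → toℕ a < toℕ p → t p < t a → D a
    mustD {a} {p} a<p tp<ta with next {a} {p} a<p
    ... | b , eb with <-cmp (t b) (t a)
    ...   | tri< lt _ _ = mkD eb lt
    ...   | tri≈ _ eq _ = ⊥-elim (1+n≢n (trans (sym eb) (cong toℕ (s-inj {b} {a} eq))))
    ...   | tri> _ _ gt = ⊥-elim (av a b p (≤-reflexive (sym eb)) b<p (tp<ta , gt))
      where
      b≢p : toℕ b ≢ toℕ p
      b≢p e = <-asym gt (subst (λ z → t z < t a) (sym (Fin.toℕ-injective e)) tp<ta)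
      b<p : toℕ b < toℕ p
      b<p = ≤∧≢⇒< (subst (_≤ toℕ p) (sym eb) a<p) b≢p

  D⇒iDes : ∀ a → Des σ [ a ]₁ → iDes σ (toℕ (σ ⟨$⟩ʳ a))
  D⇒iDes a d with unD d
  ... | b , eb , tb<ta = u , s a , eu , refl , a<p′
    where
    pa : suc (pred (t a)) ≡ t a
    pa = suc-pred (t a) {{>-nonZero (≤-<-trans z≤n tb<ta)}}
    u<n : pred (t a) < n
    u<n = ≤-trans (≤-reflexive pa) (<⇒≤ (Fin.toℕ<n (s a)))
    u : Fin n
    u = fromℕ< u<n
    eu : suc (toℕ u) ≡ t a
    eu = trans (cong suc (Fin.toℕ-fromℕ< u<n)) pa
    p : Fin n
    p = σ ⟨$⟩ˡ u
    tp : suc (t p) ≡ t a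
    tp = trans (cong (suc ∘ toℕ) (inverseʳ σ)) eu
    tb≤tp : t b ≤ t p
    tb≤tp = s≤s⁻¹ (≤-trans tb<ta (≤-reflexive (sym tp)))
    a<b : toℕ a < toℕ b
    a<b = ≤-reflexive (sym eb)
    a<p : toℕ a < toℕ p
    a<p with <-cmp (toℕ a) (toℕ p)
    ... | tri< lt _ _ = lt
    ... | tri≈ _ eq _ = ⊥-elim (1+n≢n (trans tp (cong t (Fin.toℕ-injective eq))))
    ... | tri> _ _ p<a = ⊥-elim (av p a b p<a a<b (tb<tp , ≤-reflexive tp))
      where
      tb<tp : t b < t p
      tb<tp = ≤∧≢⇒< tb≤tp λ e →
        <-irrefl (cong toℕ (sym (s-inj {b} {p} e))) (<-trans p<a a<b)
    a<p′ : toℕ (σ ⟨$⟩ˡ s a) < toℕ p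
    a<p′ = subst (λ z → toℕ z < toℕ p) (sym (inverseˡ σ)) a<p

  iDes⇒D : ∀ a → iDes σ (toℕ (σ ⟨$⟩ʳ a)) → Des σ [ a ]₁
  iDes⇒D a (u , w , eu , ew , lt) with Fin.toℕ-injective (suc-injective ew)
  ... | refl = mustD {a} {σ ⟨$⟩ˡ u} (subst (λ z → toℕ z < toℕ (σ ⟨$⟩ˡ u)) (inverseˡ σ) lt)
                 (≤-reflexive (trans (cong (suc ∘ toℕ) (inverseʳ σ)) eu))

  -- v ∈ iDes σ exactly when the position of the value v + 1 is a descent, so L m
  -- counts the inverse descents v ≤ m by that position; R m counts the descents
  -- i ≤ m. If some descent past m has a value ≤ m + 1, then each value > m + 1
  -- among the first m positions sits at a descent.
  private
    L R : ℕ → Fin n → ℕ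
    L m a = ind (D? a ×-dec (t a ≤? m))
    R m a = ind (D? a ×-dec (suc (toℕ a) ≤? m))

    stop : ∀ v a → t a ≤ v → ∃[ c ] toℕ a ≤ toℕ c × t c ≤ t a × ¬ D c
    stop v a le with D? a
    ... | no ¬d = a , ≤-refl , ≤-refl , ¬d
    ... | yes d with unD d
    stop zero    a le | yes d | b , eb , lt = ⊥-elim (n≮0 (≤-trans lt le))
    stop (suc v) a le | yes d | b , eb , lt with stop v b (s≤s⁻¹ (≤-trans lt le))
    ... | c , b≤c , tc≤ , ¬d =
      c , ≤-trans (≤-trans (n≤1+n _) (≤-reflexive (sym eb))) b≤c , ≤-trans tc≤ (<⇒≤ lt) , ¬d

    L≤R : ∀ m → sumᶠ (L m) ≤ sumᶠ (R m)
    L≤R m with Fin.any? (λ a → D? a ×-dec (t a ≤? m) ×-dec (m ≤? toℕ a))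
    ... | no none = sumᶠ-mono (L m) (R m) λ a →
            ind-mono (D? a ×-dec (t a ≤? m)) (D? a ×-dec (suc (toℕ a) ≤? m))
              λ (d , le) → d , ≰⇒> (λ m≤a → none (a , d , le , m≤a))
    ... | yes (a₀ , d₀ , ta₀≤m , m≤a₀) with unD d₀ | stop (t a₀) a₀ ≤-refl
    ...   | b₀ , eb₀ , tb₀<ta₀ | c , a₀≤c , tc≤ta₀ , ¬dc = s≤s⁻¹ (+-cancelʳ-≤ B _ _ (begin
        suc (sumᶠ (L m)) + B        ≡⟨ cong suc (∑-distrib-+ (L m) below) ⟨
        suc (sumᶠ (λ a → L m a + below a))
                                    ≤⟨ sumᶠ-mono-< _ _ pt c pt-c ⟩
        sumᶠ (λ a → R m a + small a) ≡⟨ ∑-distrib-+ (R m) small ⟩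
        sumᶠ (R m) + sumᶠ small     ≡⟨ cong (sumᶠ (R m) +_) (sum-permute (λ b → ind (toℕ b ≤? m)) σ) ⟨
        sumᶠ (R m) + sumᶠ {n} (λ b → ind (toℕ b ≤? m))
                                    ≤⟨ +-monoʳ-≤ (sumᶠ (R m)) (≤-vs-< n m) ⟩
        sumᶠ (R m) + suc B          ≡⟨ +-suc _ B ⟩
        suc (sumᶠ (R m)) + B        ∎))
      where
      open ≤-Reasoning
      below small : Fin n → ℕ
      below a = ind (toℕ a <? m)
      small a = ind (t a ≤? m)
      B : ℕ
      B = sumᶠ below
      m<b₀ : m < toℕ b₀
      m<b₀ = ≤-trans (s≤s m≤a₀) (≤-reflexive (sym eb₀))
      big⇒D : ∀ a → toℕ a < m → ¬ (t a ≤ m) → D a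
      big⇒D a a<m big = mustD {a} {b₀} (<-trans a<m m<b₀)
        (<-trans (<-≤-trans tb₀<ta₀ ta₀≤m) (≰⇒> big))
      pt : ∀ a → L m a + below a ≤ R m a + small a
      pt a = ind-exchange (D? a) (t a ≤? m) (suc (toℕ a) ≤? m) (big⇒D a)
      pt-c : L m c + below c < R m c + small c
      pt-c = subst₂ _<_
        (sym (cong₂ _+_ (ind-no (D? c ×-dec (t c ≤? m)) (¬dc ∘ proj₁))
                        (ind-no (toℕ c <? m) (≤⇒≯ (≤-trans m≤a₀ a₀≤c)))))
        (sym (cong₂ _+_ (ind-no (D? c ×-dec (suc (toℕ c) ≤? m)) (¬dc ∘ proj₁))
                        (ind-yes (t c ≤? m) (≤-trans tc≤ta₀ ta₀≤m))))
        z<s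

  count≤ : ∀ m →
    sumᶠ {n} (λ b → ind (iDes? σ (toℕ b) ×-dec (toℕ b ≤? m))) ≤
    sumᶠ {n} (λ a → ind (Des? σ [ a ]₁ ×-dec ([ a ]₁ ≤? m)))
  count≤ m = begin
    sumᶠ {n} (λ b → ind (iDes? σ (toℕ b) ×-dec (toℕ b ≤? m)))
      ≡⟨ sum-permute (λ b → ind (iDes? σ (toℕ b) ×-dec (toℕ b ≤? m))) σ ⟩
    sumᶠ (λ a → ind (iDes? σ (t a) ×-dec (t a ≤? m)))
      ≤⟨ sumᶠ-mono _ _ (λ a → ind-mono (iDes? σ (t a) ×-dec (t a ≤? m)) (D? a ×-dec (t a ≤? m))
           λ (d , le) → iDes⇒D a d , le) ⟩
    sumᶠ (L m)
      ≤⟨ L≤R m ⟩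
    sumᶠ (R m) ∎
    where open ≤-Reasoning

  count≡ : sumᶠ {n} (λ b → ind (iDes? σ (toℕ b))) ≡ sumᶠ {n} (λ a → ind (Des? σ [ a ]₁))
  count≡ = trans (sum-permute (λ b → ind (iDes? σ (toℕ b))) σ)
    (sum-cong-≗ λ a → ind-cong (iDes? σ (t a)) (D? a) (iDes⇒D a) (D⇒iDes a))

------------------------------------------------------------------------

#≤ : ℕ → List ℕ → ℕ
#≤ m xs = length (filter (_≤? m) xs)

length-elements : ∀ {P : Pred ℕ 0ℓ} (P? : Decidable P) (f : ℕ → ℕ) n →
  length (filter P? (applyUpTo f n)) ≡ sumᶠ {n} (λ a → ind (P? (f (toℕ a))))
length-elements P? f zero    = refl
length-elements P? f (suc n) with does (P? (f 0))
... | true  = cong suc (length-elements P? (f ∘ suc) n)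
... | false = length-elements P? (f ∘ suc) n

#≤-elements : ∀ {P : Pred ℕ 0ℓ} (P? : Decidable P) m (f : ℕ → ℕ) n →
  #≤ m (filter P? (applyUpTo f n)) ≡
  sumᶠ {n} (λ a → ind (P? (f (toℕ a)) ×-dec (f (toℕ a) ≤? m)))
#≤-elements P? m f zero    = refl
#≤-elements P? m f (suc n) with P? (f 0)
... | no _  = #≤-elements P? m (f ∘ suc) n
... | yes _ with does (f 0 ≤? m)
...   | true  = cong suc (#≤-elements P? m (f ∘ suc) n)
...   | false = #≤-elements P? m (f ∘ suc) n

¬Des-0 : ∀ {n} (σ : Permutation′ n) → ¬ Des σ 0
¬Des-0 σ (_ , _ , () , _)

¬Des-n : ∀ {n} (σ : Permutation′ n) → ¬ Des σ n
¬Des-n {n} σ (_ , b , _ , eb , _) = <-irrefl (suc-injective eb) (Fin.toℕ<n b)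

des≡ides : ∀ {n} (σ : Permutation′ n) → Avoids231 σ →
  length (elements (Des? σ) n) ≡ length (elements (iDes? σ) n)
des≡ides {n} σ av = trans (length-elements (Des? σ) id n)
  (trans (sumᶠ-shift n (ind ∘ Des? σ) (ind-no (Des? σ 0) (¬Des-0 σ)) (ind-no (Des? σ n) (¬Des-n σ)))
  (trans (sym (count≡ σ av)) (sym (length-elements (iDes? σ) id n))))

#≤-iDes≤Des : ∀ {n} (σ : Permutation′ n) → Avoids231 σ → ∀ m →
  #≤ m (elements (iDes? σ) n) ≤ #≤ m (elements (Des? σ) n)
#≤-iDes≤Des {n} σ av m = begin
  #≤ m (elements (iDes? σ) n)
    ≡⟨ #≤-elements (iDes? σ) m id n ⟩
  sumᶠ {n} (λ b → ind (iDes? σ (toℕ b) ×-dec (toℕ b ≤? m)))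
    ≤⟨ count≤ σ av m ⟩
  sumᶠ {n} (g ∘ suc ∘ toℕ)
    ≡⟨ sumᶠ-shift n g (ind-no (Des? σ 0 ×-dec (0 ≤? m)) (¬Des-0 σ ∘ proj₁))
                      (ind-no (Des? σ n ×-dec (n ≤? m)) (¬Des-n σ ∘ proj₁)) ⟨
  sumᶠ {n} (g ∘ toℕ)
    ≡⟨ #≤-elements (Des? σ) m id n ⟨
  #≤ m (elements (Des? σ) n) ∎
  where
  open ≤-Reasoning
  g : ℕ → ℕ
  g i = ind (Des? σ i ×-dec (i ≤? m))

elements-sorted : ∀ {P : Pred ℕ 0ℓ} (P? : Decidable P) n → AllPairs _<_ (elements P? n)
elements-sorted P? n = AllPairs.filter⁺ P? (AllPairs.applyUpTo⁺₁ id n (λ i<j _ → i<j))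

elements-bounded : ∀ {P : Pred ℕ 0ℓ} (P? : Decidable P) n → All (_< n) (elements P? n)
elements-bounded P? n = All.filter⁺ P? (All.all-upTo n)

#≤-accept : ∀ {m x} xs → x ≤ m → #≤ m (x ∷ xs) ≡ suc (#≤ m xs)
#≤-accept {m} xs le = cong length (filter-accept (_≤? m) {xs = xs} le)

#≤-none : ∀ {m} xs → All (m <_) xs → #≤ m xs ≡ 0
#≤-none {m} xs lts = cong length (filter-none (_≤? m) (All.map <⇒≱ lts))

-- Sorted lists of equal length with these counts compare entrywise.
pointwise-≤ : ∀ xs ys → AllPairs _<_ xs → AllPairs _<_ ys → length xs ≡ length ys →
          (∀ m → #≤ m ys ≤ #≤ m xs) → Pointwise _≤_ xs ys
pointwise-≤ []       []       _          _          _  _ = []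
pointwise-≤ (x ∷ xs) (y ∷ ys) (x< ∷ sxs) (y< ∷ sys) eq h =
  x≤y ∷ pointwise-≤ xs ys sxs sys (suc-injective eq) h′
  where
  x≤y : x ≤ y
  x≤y with x ≤? y
  ... | yes le = le
  ... | no ¬le = ⊥-elim (n≮0 (begin
    suc (#≤ y ys)  ≡⟨ #≤-accept ys ≤-refl ⟨
    #≤ y (y ∷ ys)  ≤⟨ h y ⟩
    #≤ y (x ∷ xs)  ≡⟨ #≤-none (x ∷ xs) (≰⇒> ¬le ∷ All.map (<-trans (≰⇒> ¬le)) x<) ⟩
    0              ∎))
    where open ≤-Reasoning
  h′ : ∀ m → #≤ m ys ≤ #≤ m xs
  h′ m with y ≤? m
  ... | yes le = s≤s⁻¹ (subst₂ _≤_ (#≤-accept ys le) (#≤-accept xs (≤-trans x≤y le)) (h m))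
  ... | no ¬le = ≤-trans (≤-reflexive (#≤-none ys (All.map (<-trans (≰⇒> ¬le)) y<))) z≤n

------------------------------------------------------------------------
-- Paths whose corners rise weakly above the diagonal, up to (n , n)

data Rising (n : ℕ) : ℕ × ℕ → List (ℕ × ℕ) → Set where
  end  : Rising n (n , n) []
  step : ∀ {x y x′ y′ ps} → x ≤ x′ → y ≤ y′ → x′ ≤ y′ →
         Rising n (x′ , y′) ps → Rising n (x , y) ((x′ , y′) ∷ ps)

rising : ∀ {n x y} xs ys → x ≤ n → y ≤ n → All (x <_) xs → All (y <_) ys →
  All (_< n) xs → All (_< n) ys → AllPairs _<_ xs → AllPairs _<_ ys →
  Pointwise _≤_ xs ys → Rising n (x , y) (zip (xs ∷ʳ n) (ys ∷ʳ n))
rising [] [] x≤n y≤n _ _ _ _ _ _ [] = step x≤n y≤n ≤-refl end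
rising (x ∷ xs) (y ∷ ys) _ _ (lx ∷ _) (ly ∷ _) (x<n ∷ xs<n) (y<n ∷ ys<n) (x< ∷ sxs) (y< ∷ sys) (x≤y ∷ pw) =
  step (<⇒≤ lx) (<⇒≤ ly) x≤y (rising xs ys (<⇒≤ x<n) (<⇒≤ y<n) x< y< xs<n ys<n sxs sys pw)

#𝟘-𝟘s : ∀ k w → #[ 𝟘 ] (replicate k 𝟘 ++ w) ≡ k + #[ 𝟘 ] w
#𝟘-𝟘s zero    w = refl
#𝟘-𝟘s (suc k) w = cong suc (#𝟘-𝟘s k w)

#𝟘-𝟙s : ∀ k w → #[ 𝟘 ] (replicate k 𝟙 ++ w) ≡ #[ 𝟘 ] w
#𝟘-𝟙s zero    w = refl
#𝟘-𝟙s (suc k) w = #𝟘-𝟙s k w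

#𝟙-𝟘s : ∀ k w → #[ 𝟙 ] (replicate k 𝟘 ++ w) ≡ #[ 𝟙 ] w
#𝟙-𝟘s zero    w = refl
#𝟙-𝟘s (suc k) w = #𝟙-𝟘s k w

#𝟙-𝟙s : ∀ k w → #[ 𝟙 ] (replicate k 𝟙 ++ w) ≡ k + #[ 𝟙 ] w
#𝟙-𝟙s zero    w = refl
#𝟙-𝟙s (suc k) w = cong suc (#𝟙-𝟙s k w)

path-norths : ∀ {n x y ps} → Rising n (x , y) ps → y + #[ 𝟘 ] (path (x , y) ps) ≡ n
path-norths end = +-identityʳ _
path-norths {x = x} {y} (step {x′ = x′} {y′} {ps} x≤ y≤ _ r) = trans
  (cong (y +_) (trans (#𝟘-𝟘s (y′ ∸ y) _) (cong (y′ ∸ y +_) (#𝟘-𝟙s (x′ ∸ x) _))))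
  (trans (sym (+-assoc y (y′ ∸ y) _))
  (trans (cong (_+ #[ 𝟘 ] w) (m+[n∸m]≡n y≤)) (path-norths r)))
  where
  w : Word
  w = path (x′ , y′) ps

path-easts : ∀ {n x y ps} → Rising n (x , y) ps → x + #[ 𝟙 ] (path (x , y) ps) ≡ n
path-easts end = +-identityʳ _
path-easts {x = x} {y} (step {x′ = x′} {y′} {ps} x≤ y≤ _ r) = trans
  (cong (x +_) (trans (#𝟙-𝟘s (y′ ∸ y) _) (#𝟙-𝟙s (x′ ∸ x) _)))
  (trans (sym (+-assoc x (x′ ∸ x) _))
  (trans (cong (_+ #[ 𝟙 ] w) (m+[n∸m]≡n x≤)) (path-easts r)))
  where
  w : Word
  w = path (x′ , y′) ps

-- The prefix condition for a path starting at (x , y).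
Above : ℕ → ℕ → Word → Set
Above x y w = ∀ i → x + #[ 𝟙 ] (take i w) ≤ y + #[ 𝟘 ] (take i w)

above-𝟘s : ∀ k {x y w} → x ≤ y → Above x (y + k) w → Above x y (replicate k 𝟘 ++ w)
above-𝟘s zero    {x} {y} {w} le h i = subst (λ z → Above x z w) (+-identityʳ y) h i
above-𝟘s (suc k) {x} {y} {w} le h zero    = +-monoˡ-≤ 0 le
above-𝟘s (suc k) {x} {y} {w} le h (suc i) = ≤-trans
  (above-𝟘s k (m≤n⇒m≤1+n le) (subst (λ z → Above x z w) (+-suc y k) h) i)
  (≤-reflexive (sym (+-suc y _)))

above-𝟙s : ∀ k {x y w} → x + k ≤ y → Above (x + k) y w → Above x y (replicate k 𝟙 ++ w)
above-𝟙s zero    {x} {y} {w} le h i = subst (λ z → Above z y w) (+-identityʳ x) h i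
above-𝟙s (suc k) {x} {y} {w} le h zero    = +-monoˡ-≤ 0 (≤-trans (m≤m+n x (suc k)) le)
above-𝟙s (suc k) {x} {y} {w} le h (suc i) = ≤-trans (≤-reflexive (+-suc x _))
  (above-𝟙s k (≤-trans (≤-reflexive (sym (+-suc x k))) le)
    (subst (λ z → Above z y w) (+-suc x k) h) i)

path-above : ∀ {n x y ps} → x ≤ y → Rising n (x , y) ps → Above x y (path (x , y) ps)
path-above le end zero    = ≤-refl
path-above le end (suc i) = ≤-refl
path-above {x = x} {y} le (step {x′ = x′} {y′} {ps} x≤ y≤ x′≤y′ r) =
  above-𝟘s (y′ ∸ y) le (subst (λ z → Above x z (replicate (x′ ∸ x) 𝟙 ++ w)) (sym (m+[n∸m]≡n y≤))
    (above-𝟙s (x′ ∸ x) (subst (_≤ y′) (sym (m+[n∸m]≡n x≤)) x′≤y′)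
      (subst (λ z → Above z y′ w) (sym (m+[n∸m]≡n x≤)) (path-above x′≤y′ r))))
  where
  w : Word
  w = path (x′ , y′) ps

Φ-rising : ∀ {n} (σ : Permutation′ n) → Avoids231 σ →
  Rising n (0 , 0) (zip (elements (Des? σ) n ∷ʳ n) (elements (iDes? σ) n ∷ʳ n))
Φ-rising {n} σ av = rising xs ys z≤n z≤n (positive σ) (positive (flip σ))
  (elements-bounded (Des? σ) n) (elements-bounded (iDes? σ) n)
  (elements-sorted (Des? σ) n) (elements-sorted (iDes? σ) n)
  (pointwise-≤ xs ys (elements-sorted (Des? σ) n) (elements-sorted (iDes? σ) n)
    (des≡ides σ av) (#≤-iDes≤Des σ av))
  where
  xs ys : List ℕ
  xs = elements (Des? σ) n
  ys = elements (iDes? σ) n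
  positive : (τ : Permutation′ n) → All (0 <_) (elements (Des? τ) n)
  positive τ = All.map (λ { (a , _ , refl , _) → z<s }) (All.all-filter (Des? τ) (upTo n))

------------------------------------------------------------------------

Φ : ∀ {n} → S₂₃₁ n → Dyck n
Φ (σ , av) = record
  { word     = Φword σ
  ; norths   = path-norths (Φ-rising σ av)
  ; easts    = path-easts (Φ-rising σ av)
  ; prefixes = path-above z≤n (Φ-rising σ av)
  }

{-# OPTIONS --safe #-}
module Submission where

-- A descent of a word drawn from the origin is the sum of its two coordinates, so
-- all three claims follow from one identity of lists: the coordinates of the
-- valleys of Φ(σ), from left to right, are the pairs (i_1 , i′_1), ...,
-- (i_k , i′_k).
--
-- Both sides of this identity equal a list computed from the word by recursion
-- (`valleys`).  For every word, `valleys` lists the coordinates of the increasing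
-- enumeration of the descents (`coords-elements`).  For the path through given
-- points, each strictly north-east of the preceding one, every block of north
-- steps and every block of east steps is nonempty, so the turns from east to north
-- are exactly the given points except the last (`valleys-path`).  The points that
-- define Φ(σ) form such a chain because Des(σ) and iDes(σ) are subsets of
-- {1,...,n-1} of equal size, so that their increasing enumerations can be paired
-- entry by entry.

open import Defs
import Data.Fin.Base as Fin
open import Data.Fin.Properties using (toℕ<n)
open import Data.Fin.Permutation using (Permutation′; flip)
open import Data.List.Base
  using (List; []; _∷_; _++_; _∷ʳ_; length; filter; map; take; replicate; upTo; applyUpTo; zip)
open import Data.List.Membership.Propositional using (_∈_)
open import Data.List.Membership.Propositional.Properties
  using (∈-map⁺; ∈-map⁻; ∈-filter⁺; ∈-filter⁻; ∈-upTo⁺)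
open import Data.List.Properties
  using (map-id; map-∘; map-cong; map-cong-local; map-applyUpTo; length-take; length-++;
         filter-accept; filter-reject; filter-≐)
open import Data.List.Relation.Unary.All as All using (All; []; _∷_)
import Data.List.Relation.Unary.All.Properties as All
open import Data.List.Relation.Unary.AllPairs using (_∷_; [])
import Data.List.Relation.Unary.AllPairs.Properties as AllPairs
open import Data.List.Relation.Unary.Linked using (Linked; []; [-]; _∷_)
open import Data.List.Relation.Unary.Linked.Properties using (AllPairs⇒Linked)
open import Data.Nat.Base using (ℕ; zero; suc; _≤_; _<_; _+_; _*_; _∸_; z<s)
open import Data.Nat.ListAction using (sum)
open import Data.Nat.Properties
open import Data.Nat.Solver using (module +-*-Solver)
open import Data.Product.Base using (_×_; _,_; proj₁; proj₂; ∃-syntax)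
open import Function.Base using (_∘_; id)
open import Level using (0ℓ)
open import Relation.Binary.Core using (Rel)
open import Relation.Binary.PropositionalEquality
  using (_≡_; refl; sym; trans; cong; cong₂; subst; module ≡-Reasoning)
open import Relation.Nullary using (¬_; yes; no)
open import Relation.Unary using (Pred; Decidable; _⊆_; _≐_)

-- Lists and increasing enumerations

filter-map : ∀ {A B : Set} {P : Pred B 0ℓ} (P? : Decidable P) (f : A → B) xs →
             filter P? (map f xs) ≡ map f (filter (P? ∘ f) xs)
filter-map P? f []       = refl
filter-map P? f (x ∷ xs) with P? (f x)
... | yes _ = cong (f x ∷_) (filter-map P? f xs)
... | no _  = filter-map P? f xs

map-proj₁-zip : ∀ {A B : Set} (xs : List A) (ys : List B) → length xs ≡ length ys →
                map proj₁ (zip xs ys) ≡ xs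
map-proj₁-zip []       []       _  = refl
map-proj₁-zip (x ∷ xs) (y ∷ ys) eq = cong (x ∷_) (map-proj₁-zip xs ys (suc-injective eq))

map-proj₂-zip : ∀ {A B : Set} (xs : List A) (ys : List B) → length xs ≡ length ys →
                map proj₂ (zip xs ys) ≡ ys
map-proj₂-zip []       []       _  = refl
map-proj₂-zip (x ∷ xs) (y ∷ ys) eq = cong (y ∷_) (map-proj₂-zip xs ys (suc-injective eq))

zip-∷ʳ : ∀ {A B : Set} (xs : List A) (ys : List B) {x y} → length xs ≡ length ys →
         zip (xs ∷ʳ x) (ys ∷ʳ y) ≡ zip xs ys ∷ʳ (x , y)
zip-∷ʳ []       []       _  = refl
zip-∷ʳ (x ∷ xs) (y ∷ ys) eq = cong ((x , y) ∷_) (zip-∷ʳ xs ys (suc-injective eq))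

sum-map-+ : ∀ {A : Set} (f g : A → ℕ) xs →
            sum (map (λ a → f a + g a) xs) ≡ sum (map f xs) + sum (map g xs)
sum-map-+ f g []       = refl
sum-map-+ f g (x ∷ xs) = trans (cong (f x + g x +_) (sum-map-+ f g xs))
  (+-*-Solver.solve 4 (λ a b c d → (a :+ b) :+ (c :+ d) := (a :+ c) :+ (b :+ d)) refl
    (f x) (g x) (sum (map f xs)) (sum (map g xs)))
  where open +-*-Solver using (_:+_; _:=_)

∈-elements⁺ : ∀ {P : Pred ℕ 0ℓ} (P? : Decidable P) {n i} → i < n → P i → i ∈ elements P? n
∈-elements⁺ P? i<n p = ∈-filter⁺ P? (∈-upTo⁺ i<n) p

∈-elements⁻ : ∀ {P : Pred ℕ 0ℓ} (P? : Decidable P) {n i} → i ∈ elements P? n → P i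
∈-elements⁻ P? {n} m = proj₂ (∈-filter⁻ P? {xs = upTo n} m)

-- Valleys of a word

-- The coordinates of the valleys, from left to right, when the word is drawn
-- from the given point.
valleys : ℕ × ℕ → Word → List (ℕ × ℕ)
valleys _       []          = []
valleys (x , y) (𝟘 ∷ w)     = valleys (x , suc y) w
valleys (x , y) (𝟙 ∷ [])    = []
valleys (x , y) (𝟙 ∷ 𝟙 ∷ w) = valleys (suc x , y) (𝟙 ∷ w)
valleys (x , y) (𝟙 ∷ 𝟘 ∷ w) = (suc x , y) ∷ valleys (suc x , y) (𝟘 ∷ w)

-- The point reached after i steps when the word is drawn from the given point.
coords : ℕ × ℕ → Word → ℕ → ℕ × ℕ
coords (x , y) w i = x + #[ 𝟙 ] (take i w) , y + #[ 𝟘 ] (take i w)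

-- The effect of a single step on the current point.
move : Step → ℕ × ℕ → ℕ × ℕ
move 𝟘 (x , y) = x , suc y
move 𝟙 (x , y) = suc x , y

coords-∷ : ∀ s p w i → coords p (s ∷ w) (suc i) ≡ coords (move s p) w i
coords-∷ 𝟘 (x , y) w i = cong (x + #[ 𝟙 ] (take i w) ,_) (+-suc y _)
coords-∷ 𝟙 (x , y) w i = cong (_, y + #[ 𝟘 ] (take i w)) (+-suc x _)

-- Descents at position 2 or later do not depend on the first letter.
DesW-∷ : ∀ s w → (DesW (s ∷ w) ∘ suc ∘ suc) ≐ (DesW w ∘ suc)
DesW-∷ s w = to , from
  where
  to : (DesW (s ∷ w) ∘ suc ∘ suc) ⊆ (DesW w ∘ suc)
  to (Fin.suc a , Fin.suc b , ea , eb , la , lb) = a , b , suc-injective ea , suc-injective eb , la , lb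
  from : (DesW w ∘ suc) ⊆ (DesW (s ∷ w) ∘ suc ∘ suc)
  from (a , b , ea , eb , la , lb) = Fin.suc a , Fin.suc b , cong suc ea , cong suc eb , la , lb

DesW-1 : ∀ {s t w} → DesW (s ∷ t ∷ w) 1 → s ≡ 𝟙 × t ≡ 𝟘
DesW-1 (Fin.zero , Fin.suc Fin.zero , _ , _ , es , et) = es , et

¬DesW-0 : ∀ w → ¬ DesW w 0
¬DesW-0 w (_ , _ , () , _)

DesW-< : ∀ w {i} → DesW w i → i < length w
DesW-< w (_ , b , _ , eb , _) = subst (_≤ length w) eb (toℕ<n b)

-- The descents of s ∷ w lie in the enumerated range 1, ..., length w.  Starting it
-- at 1 lets position 1 be split off and the rest be shifted down to the tail w.
coords-filter : ∀ p s w →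
  map (coords p (s ∷ w)) (filter (DesW? (s ∷ w)) (applyUpTo suc (length w))) ≡ valleys p (s ∷ w)

-- The descents after position 1.
coords-filter-tail : ∀ p s t w →
  map (coords p (s ∷ t ∷ w))
    (filter (DesW? (s ∷ t ∷ w)) (applyUpTo (suc ∘ suc) (length w))) ≡
  valleys (move s p) (t ∷ w)
coords-filter-tail p s t w = begin
  map c (filter D? (applyUpTo (suc ∘ suc) (length w)))
    ≡⟨ cong (map c ∘ filter D?) (map-applyUpTo suc suc (length w)) ⟨
  map c (filter D? (map suc is))
    ≡⟨ cong (map c) (filter-map D? suc is) ⟩
  map c (map suc (filter (D? ∘ suc) is))
    ≡⟨ map-∘ (filter (D? ∘ suc) is) ⟨
  map (c ∘ suc) (filter (D? ∘ suc) is)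
    ≡⟨ map-cong (coords-∷ s p (t ∷ w)) (filter (D? ∘ suc) is) ⟩
  map (coords (move s p) (t ∷ w)) (filter (D? ∘ suc) is)
    ≡⟨ cong (map (coords (move s p) (t ∷ w))) filter-is ⟩
  map (coords (move s p) (t ∷ w)) (filter (DesW? (t ∷ w)) is)
    ≡⟨ coords-filter (move s p) t w ⟩
  valleys (move s p) (t ∷ w) ∎
  where
  open ≡-Reasoning
  c = coords p (s ∷ t ∷ w)
  D? = DesW? (s ∷ t ∷ w)
  is = applyUpTo suc (length w)
  filter-is : filter (D? ∘ suc) is ≡ filter (DesW? (t ∷ w)) is
  filter-is = begin
    filter (D? ∘ suc) is
      ≡⟨ cong (filter (D? ∘ suc)) (map-applyUpTo id suc (length w)) ⟨
    filter (D? ∘ suc) (map suc (upTo (length w)))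
      ≡⟨ filter-map (D? ∘ suc) suc (upTo (length w)) ⟩
    map suc (filter (D? ∘ suc ∘ suc) (upTo (length w)))
      ≡⟨ cong (map suc) (filter-≐ (D? ∘ suc ∘ suc) (DesW? (t ∷ w) ∘ suc)
           (DesW-∷ s (t ∷ w)) (upTo (length w))) ⟩
    map suc (filter (DesW? (t ∷ w) ∘ suc) (upTo (length w)))
      ≡⟨ filter-map (DesW? (t ∷ w)) suc (upTo (length w)) ⟨
    filter (DesW? (t ∷ w)) (map suc (upTo (length w)))
      ≡⟨ cong (filter (DesW? (t ∷ w))) (map-applyUpTo id suc (length w)) ⟩
    filter (DesW? (t ∷ w)) is ∎

coords-filter p 𝟘 []      = refl
coords-filter p 𝟙 []      = refl
coords-filter p 𝟘 (t ∷ w) = trans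
  (cong (map (coords p (𝟘 ∷ t ∷ w)))
    (filter-reject (DesW? (𝟘 ∷ t ∷ w)) ((λ ()) ∘ proj₁ ∘ DesW-1)))
  (coords-filter-tail p 𝟘 t w)
coords-filter p 𝟙 (𝟙 ∷ w) = trans
  (cong (map (coords p (𝟙 ∷ 𝟙 ∷ w)))
    (filter-reject (DesW? (𝟙 ∷ 𝟙 ∷ w)) ((λ ()) ∘ proj₂ ∘ DesW-1)))
  (coords-filter-tail p 𝟙 𝟙 w)
coords-filter p@(x , y) 𝟙 (𝟘 ∷ w) = trans
  (cong (map (coords p (𝟙 ∷ 𝟘 ∷ w)))
    (filter-accept (DesW? (𝟙 ∷ 𝟘 ∷ w)) {xs = applyUpTo (suc ∘ suc) (length w)}
      (Fin.zero , Fin.suc Fin.zero , refl , refl , refl , refl)))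
  (cong₂ _∷_ (cong₂ _,_ (+-comm x 1) (+-identityʳ y)) (coords-filter-tail p 𝟙 𝟘 w))

coords-elements : ∀ p w → map (coords p w) (elements (DesW? w) (length w)) ≡ valleys p w
coords-elements p []      = refl
coords-elements p (s ∷ w) = trans
  (cong (map (coords p (s ∷ w))) (filter-reject (DesW? (s ∷ w)) (¬DesW-0 (s ∷ w))))
  (coords-filter p s w)

length-# : ∀ w → length w ≡ #[ 𝟙 ] w + #[ 𝟘 ] w
length-# []      = refl
length-# (𝟘 ∷ w) = trans (cong suc (length-# w)) (sym (+-suc (#[ 𝟙 ] w) (#[ 𝟘 ] w)))
length-# (𝟙 ∷ w) = cong suc (length-# w)

-- A position is the sum of the coordinates of the point reached there.
position : ∀ w {i} → i < length w → #[ 𝟙 ] (take i w) + #[ 𝟘 ] (take i w) ≡ i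
position w {i} i< = trans (sym (length-# (take i w)))
  (trans (length-take i w) (m≤n⇒m⊓n≡m (<⇒≤ i<)))

-- Valleys of the path through a chain of points

-- q lies strictly to the north-east of p.
_≺_ : Rel (ℕ × ℕ) 0ℓ
(x , y) ≺ (x′ , y′) = x < x′ × y < y′

valleys-𝟘s : ∀ k {x y} w → valleys (x , y) (replicate k 𝟘 ++ w) ≡ valleys (x , k + y) w
valleys-𝟘s zero            w = refl
valleys-𝟘s (suc k) {x} {y} w =
  trans (valleys-𝟘s k w) (cong (λ z → valleys (x , z) w) (+-suc k y))

valleys-𝟙s-end : ∀ k {x y} → valleys (x , y) (replicate k 𝟙 ++ []) ≡ []
valleys-𝟙s-end zero          = refl
valleys-𝟙s-end (suc zero)    = refl
valleys-𝟙s-end (suc (suc k)) = valleys-𝟙s-end (suc k)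

valleys-𝟙s-𝟘 : ∀ k {x y} w → valleys (x , y) (replicate (suc k) 𝟙 ++ 𝟘 ∷ w) ≡
  (suc k + x , y) ∷ valleys (suc k + x , y) (𝟘 ∷ w)
valleys-𝟙s-𝟘 zero            w = refl
valleys-𝟙s-𝟘 (suc k) {x} {y} w = trans (valleys-𝟙s-𝟘 k w)
  (cong (λ z → (z , y) ∷ valleys (z , y) (𝟘 ∷ w)) (cong suc (+-suc k x)))

∸-suc : ∀ {m n} → m < n → ∃[ k ] n ∸ m ≡ suc k
∸-suc {m} {n} m<n with n ∸ m | m<n⇒0<n∸m m<n
... | suc k | _ = k , refl

-- The path towards a point strictly further north starts with a north step.
path-𝟘 : ∀ {p q} ps → p ≺ q → ∃[ w ] path p (q ∷ ps) ≡ 𝟘 ∷ w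
path-𝟘 {x , y} {x′ , y′} ps (_ , y<y′) with y′ ∸ y | ∸-suc y<y′
... | _ | k , refl = _ , refl

-- The steps towards q end with at least one east step, and the steps from q start
-- with a north step, so the path turns at q and nowhere before.
valleys-turn : ∀ {p q r} ps → p ≺ q → q ≺ r →
  valleys p (path p (q ∷ r ∷ ps)) ≡ q ∷ valleys q (path q (r ∷ ps))
valleys-turn {x , y} {q@(x′ , y′)} {r} ps (x<x′ , y<y′) q≺r
  with path q (r ∷ ps) | path-𝟘 ps q≺r | x′ ∸ x | ∸-suc x<x′ | m∸n+n≡m (<⇒≤ x<x′)
... | _ | w , refl | _ | k , refl | eqx = begin
  valleys (x , y) (replicate (y′ ∸ y) 𝟘 ++ replicate (suc k) 𝟙 ++ 𝟘 ∷ w)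
    ≡⟨ valleys-𝟘s (y′ ∸ y) _ ⟩
  valleys (x , y′ ∸ y + y) (replicate (suc k) 𝟙 ++ 𝟘 ∷ w)
    ≡⟨ cong (λ z → valleys (x , z) (replicate (suc k) 𝟙 ++ 𝟘 ∷ w)) (m∸n+n≡m (<⇒≤ y<y′)) ⟩
  valleys (x , y′) (replicate (suc k) 𝟙 ++ 𝟘 ∷ w)
    ≡⟨ valleys-𝟙s-𝟘 k w ⟩
  (suc k + x , y′) ∷ valleys (suc k + x , y′) (𝟘 ∷ w)
    ≡⟨ cong (λ z → (z , y′) ∷ valleys (z , y′) (𝟘 ∷ w)) eqx ⟩
  q ∷ valleys q (𝟘 ∷ w) ∎
  where open ≡-Reasoning

valleys-path : ∀ {p} ps q → Linked _≺_ (p ∷ ps ∷ʳ q) → valleys p (path p (ps ∷ʳ q)) ≡ ps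
valleys-path {x , y} []        (x′ , y′) _ =
  trans (valleys-𝟘s (y′ ∸ y) _) (valleys-𝟙s-end (x′ ∸ x))
valleys-path (p₁ ∷ [])      q (lt ∷ lt′ ∷ l) =
  trans (valleys-turn [] lt lt′) (cong (p₁ ∷_) (valleys-path [] q (lt′ ∷ l)))
valleys-path (p₁ ∷ p₂ ∷ ps) q (lt ∷ lt′ ∷ l) =
  trans (valleys-turn (ps ∷ʳ q) lt lt′) (cong (p₁ ∷_) (valleys-path (p₂ ∷ ps) q (lt′ ∷ l)))

zip-chain : ∀ {xs ys} → length xs ≡ length ys → Linked _<_ xs → Linked _<_ ys →
            Linked _≺_ (zip xs ys)
zip-chain eq []       []       = []
zip-chain eq [-]      [-]      = [-]
zip-chain eq (x< ∷ l) (y< ∷ m) = (x< , y<) ∷ zip-chain (suc-injective eq) l m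

-- Valleys of Φ(σ)

Des-< : ∀ {n} (σ : Permutation′ n) {i} → Des σ i → i < n
Des-< {n} σ (_ , b , _ , eb , _) = subst (_≤ n) eb (toℕ<n b)

-- The hypothesis n ≥ 1 covers the permutations without descents, for which the
-- chain is 0 < n.
Des-chain : ∀ {n} (σ : Permutation′ n) → 1 ≤ n →
            Linked _<_ (0 ∷ elements (Des? σ) n ∷ʳ n)
Des-chain {n} σ 1≤n = AllPairs⇒Linked
  (All.++⁺ positive (1≤n ∷ []) ∷
   AllPairs.++⁺ (elements-sorted (Des? σ) n) ([] ∷ [])
     (All.map (_∷ []) (elements-bounded (Des? σ) n)))
  where
  positive : All (0 <_) (elements (Des? σ) n)
  positive = All.map (λ { (a , _ , refl , _) → z<s }) (All.all-filter (Des? σ) (upTo n))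

valleys-Φword : ∀ {n} (σ : Permutation′ n) → Avoids231 σ → 1 ≤ n →
  valleys (0 , 0) (Φword σ) ≡ zip (elements (Des? σ) n) (elements (iDes? σ) n)
valleys-Φword {n} σ av 1≤n = trans
  (cong (valleys (0 , 0) ∘ path (0 , 0)) zip≡)
  (valleys-path (zip xs ys) (n , n)
    (subst (λ ps → Linked _≺_ ((0 , 0) ∷ ps)) zip≡
      (zip-chain lengths (Des-chain σ 1≤n) (Des-chain (flip σ) 1≤n))))
  where
  xs = elements (Des? σ) n
  ys = elements (iDes? σ) n
  zip≡ : zip (xs ∷ʳ n) (ys ∷ʳ n) ≡ zip xs ys ∷ʳ (n , n)
  zip≡ = zip-∷ʳ xs ys (des≡ides σ av)
  lengths : length (0 ∷ xs ∷ʳ n) ≡ length (0 ∷ ys ∷ʳ n)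
  lengths = cong suc (trans (length-++ xs) (trans (cong (_+ 1) (des≡ides σ av))
    (sym (length-++ ys))))

-- The image of P under f is Q if f maps the list of members of P to the list of
-- members of Q.  The bounds ensure that these lists miss no member.
image-≐ : ∀ {P Q : Pred ℕ 0ℓ} (P? : Decidable P) (Q? : Decidable Q) (f : ℕ → ℕ) {m n} →
  (∀ {i} → P i → i < m) → (∀ {i} → Q i → i < n) →
  map f (elements P? m) ≡ elements Q? n →
  (λ x → ∃[ i ] P i × f i ≡ x) ≐ Q
image-≐ {P} {Q} P? Q? f {m} {n} P< Q< eq = to , from
  where
  to : (λ x → ∃[ i ] P i × f i ≡ x) ⊆ Q
  to (i , p , refl) =
    ∈-elements⁻ Q? {n} (subst (f i ∈_) eq (∈-map⁺ f (∈-elements⁺ P? (P< p) p)))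
  from : Q ⊆ (λ x → ∃[ i ] P i × f i ≡ x)
  from {x} q with ∈-map⁻ f (subst (x ∈_) (sym eq) (∈-elements⁺ Q? (Q< q) q))
  ... | i , i∈ , x≡fi = i , ∈-elements⁻ P? {m} i∈ , sym x≡fi

corollary3p12 : (n : ℕ) → 1 ≤ n → (σ : S₂₃₁ n) →
    (SetX (Φ σ) ≐ Des (proj₁ σ))
    × (SetY (Φ σ) ≐ iDes (proj₁ σ))
    × (majD (Φ σ) ≡ maj (proj₁ σ) + imaj (proj₁ σ))
corollary3p12 n 1≤n (σ , av) =
    image-≐ (DesW? w) (Des? σ) xc DesD-< (Des-< σ) xs≡
  , image-≐ (DesW? w) (iDes? σ) yc DesD-< (Des-< (flip σ)) ys≡
  , (begin
      sum is                               ≡⟨ cong sum positions ⟨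
      sum (map (λ i → xc i + yc i) is)     ≡⟨ sum-map-+ xc yc is ⟩
      sum (map xc is) + sum (map yc is)    ≡⟨ cong₂ (λ l l′ → sum l + sum l′) xs≡ ys≡ ⟩
      maj σ + imaj σ                       ∎)
  where
  open ≡-Reasoning
  D = Φ (σ , av)
  w = word D
  xc yc : ℕ → ℕ
  xc = xcoord D
  yc = ycoord D
  length-w : length w ≡ 2 * n
  length-w = trans (length-# w)
    (cong₂ _+_ (easts D) (trans (norths D) (sym (+-identityʳ n))))
  DesD-< : ∀ {i} → DesD D i → i < 2 * n
  DesD-< {i} d = subst (i <_) length-w (DesW-< w d)
  is : List ℕ
  is = elements (DesW? w) (2 * n)
  coords-is : map (coords (0 , 0) w) is ≡ zip (elements (Des? σ) n) (elements (iDes? σ) n)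
  coords-is = trans
    (cong (map (coords (0 , 0) w) ∘ elements (DesW? w)) (sym length-w))
    (trans (coords-elements (0 , 0) w) (valleys-Φword σ av 1≤n))
  xs≡ : map xc is ≡ elements (Des? σ) n
  xs≡ = trans (map-∘ is)
    (trans (cong (map proj₁) coords-is) (map-proj₁-zip _ _ (des≡ides σ av)))
  ys≡ : map yc is ≡ elements (iDes? σ) n
  ys≡ = trans (map-∘ is)
    (trans (cong (map proj₂) coords-is) (map-proj₂-zip _ _ (des≡ides σ av)))
  -- Each descent is the sum of its coordinates.
  positions : map (λ i → xc i + yc i) is ≡ is
  positions = trans
    (map-cong-local (All.map (λ i< → position w (subst (_ <_) (sym length-w) i<))
      (elements-bounded (DesW? w) (2 * n))))
    (map-id is)
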